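{- Let $G$ be a nontrivial strongly connected graph with $N$ nodes, of girth $g$ and cyclicity $c$. Then the exploration penalty $ep(G)$ is well-defined (i.e. an integer $k$ with the defining property exists) and satisfies $$ep(G)\le 2\frac{g}{c}N-\frac{g}{c}-2g+c.$$ If moreover $G$ is primitive (i.e. $c=1$), then $ep(G)\le N+(N-2)g$.
   Context: A graph is $(V,E)$ with $V$ finite nonempty and $E\subseteq V\times V$ (directed, loops allowed); it is nontrivial if $E\neq\emptyset$. A path is a finite sequence of consecutive edges (repetitions allowed); the empty path at a node is allowed and has length $0$; the length is the number of edges. A path is closed if its start and end nodes coincide. The girth $g$ is the minimum length of nonempty (elementary) closed paths. The cyclicity $c$ of a strongly connected graph is the gcd of the lengths of its nonempty closed paths. The exploration penalty $ep(G)$ is the smallest integer $k$ such that for every node $i$ and every integer $n\ge k$ that is a multiple of $c$ there is a closed path of length $n$ starting at $i$. -}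

module Defs where

open import Data.Fin.Base using (Fin)
open import Data.Integer.Base as ℤ using (ℤ; +_)
import Data.Integer.Divisibility as ℤ
open import Data.Nat.Base using (ℕ; zero; suc; _≤_; NonZero)
open import Data.Nat.Divisibility using (_∣_; 0∣⇒≡0)
open import Data.Product.Base using (∃-syntax; _×_; proj₁)
open import Level using (0ℓ)
open import Relation.Binary.Core using (Rel)
open import Relation.Binary.Construct.Closure.ReflexiveTransitive using (Star; fold)
open import Relation.Binary.Definitions using (Decidable)
open import Relation.Binary.PropositionalEquality.Core using (_≡_; subst)

-- Decidability of the edge relation is automatic classically; constructively
-- it expresses that E is a subset of the finite set V × V.
record Graph (N : ℕ) : Set₁ where
  field
    ⦃ nonEmpty ⦄ : NonZero N
    E            : Rel (Fin N) 0ℓ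
    E?           : Decidable E

module _ {N : ℕ} (G : Graph N) where
  open Graph G

  Nontrivial : Set
  Nontrivial = ∃[ i ] ∃[ j ] E i j

  Path : Rel (Fin N) 0ℓ
  Path = Star E

  length : ∀ {i j} → Path i j → ℕ
  length = fold (λ _ _ → ℕ) (λ _ n → suc n) zero

  StronglyConnected : Set
  StronglyConnected = ∀ i j → Path i j

  NonemptyClosedPathLength : ℕ → Set
  NonemptyClosedPathLength n =
    NonZero n × (∃[ i ] ∃[ p ] length {i} {i} p ≡ n)

  record IsGirth (g : ℕ) : Set where
    field
      attained : NonemptyClosedPathLength g
      minimal  : ∀ n → NonemptyClosedPathLength n → g ≤ n

  -- The set of lengths is infinite, so the gcd is specified as in
  -- Data.Nat.GCD.GCD instead of being computed.
  record IsCyclicity (c : ℕ) : Set where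
    field
      commonDivisor : ∀ n → NonemptyClosedPathLength n → c ∣ n
      greatest      : ∀ d → (∀ n → NonemptyClosedPathLength n → d ∣ n) → d ∣ c

  -- k and n range over all integers.  A negative n is never the length of a
  -- path, which is what bounds the admissible k from below.
  ClosedPathsFrom : (c : ℕ) → ℤ → Set
  ClosedPathsFrom c k =
    ∀ (i : Fin N) (n : ℤ) → k ℤ.≤ n → (+ c) ℤ.∣ n →
    ∃[ p ] + (length {i} {i} p) ≡ n

  -- c is the cyclicity of G.
  record IsExplorationPenalty (c : ℕ) (k : ℤ) : Set where
    field
      holds    : ClosedPathsFrom c k
      smallest : ∀ k′ → ClosedPathsFrom c k′ → k ℤ.≤ k′

module _ {N : ℕ} {G : Graph N} {g c : ℕ} where

  cyclicity∣girth : IsGirth G g → IsCyclicity G c → c ∣ g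
  cyclicity∣girth isG isC =
    IsCyclicity.commonDivisor isC g (IsGirth.attained isG)

  cyclicity-nonZero : IsGirth G g → IsCyclicity G c → NonZero c
  cyclicity-nonZero isG isC = nonZero (proj₁ (IsGirth.attained isG)) (cyclicity∣girth isG isC)
    where
    nonZero : ∀ {m d} → NonZero m → d ∣ m → NonZero d
    nonZero {d = suc _} _   _   = _
    nonZero {d = zero}  m≢0 0∣m = subst NonZero (0∣⇒≡0 0∣m) m≢0

{-# OPTIONS --safe #-}
module Submission where

-- Write h = g / c, and fix a node i and a multiple n of c with
--   n ≥ N + h N + c - 1 - 2 g.
-- A closed walk of length n at i is assembled from three pieces.
--
-- The class of a node w is the residue modulo c of the lengths of the walks
-- from w to i; it is well defined because c divides the length of every closed
-- walk.  By pigeonhole (`small-fibre`) some class s < c has M + 1 nodes with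
-- c (M + 1) ≤ N, hence g (M + 1) ≤ h N.  The last piece is a walk of length
-- exactly s into i; its first node w is in the class s.
--
-- Let C be a closed walk of length g.  Its g nodes are distinct, since a
-- repetition would give a shorter closed walk (`sources-unique`), so a walk from
-- i that avoids C and does not repeat nodes has at most N - g steps, and i
-- reaches C in at most N - g steps (`toCycle`).  Running on along C, the first
-- piece can be given any length L ≥ N - g.  Take L = n - s - M g, which is large
-- enough by the choice of n; the node v where it ends is then in the class s.
--
-- The middle piece goes from v to w in exactly M g steps (`uniformReach`).
-- Consider the graph whose edges are the walks of length g.  It has a loop at v,
-- because v lies on C, and its edges preserve the class because c divides g.  So
-- once w is reachable from v in it, w is reachable in at most M steps, and in
-- exactly M steps after going around the loop.  That w is reachable
-- (`reachable`) is where the cyclicity enters: the residues modulo g of the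
-- lengths of closed walks at v form a subgroup, whose least positive generator
-- divides all closed walk lengths, hence divides c; so every multiple of c is
-- the length of a closed walk at v up to multiples of g.
--
-- Taking a least generator is not constructive, so this only refutes that there
-- is no closed walk of length n at i; as the existence of a walk of given
-- length is decidable, the double negation can be removed.  The penalty is then
-- found by searching downwards from the threshold K = N + h N + c - 1 - 2 g.
-- The search stops above - c, since no path has length - c.
-- The two bounds follow from
--   (2 h N - h - 2 g + c) - K = (h - 1) (N - 1) ≥ 0
-- and, when c = 1, from K = N + (N - 2) g.

module WalkLengths where

  open import Data.Fin.Base as Fin using (Fin; zero; suc; toℕ; inject≤; remQuot; combine)
  import Data.Fin.Properties as Fin
  open import Data.List.Base using (List; []; _∷_; _++_; length; filter; lookup; allFin)
  open import Data.List.Properties using (length-++; filter-notAll)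
  open import Data.List.Membership.Propositional using (_∈_; lose)
  open import Data.List.Membership.Propositional.Properties using (∈-lookup; ∈-filter⁺; ∈-filter⁻; ∈-allFin; ∈-length)
  import Data.List.Relation.Unary.All as All
  open import Data.List.Relation.Unary.AllPairs using ([]; _∷_)
  open import Data.List.Relation.Unary.Any using (here; there)
  open import Data.List.Relation.Unary.Unique.Propositional using (Unique)
  import Data.List.Relation.Unary.Unique.Propositional.Properties as Unique
  open import Data.Nat.Base
  open import Data.Nat.DivMod using (m≡m%n+[m/n]*n; m%n<n; m/n*n≤m; %-remove-+ˡ; %-remove-+ʳ; m<n⇒m%n≡m)
  open import Data.Nat.Divisibility using (_∣_; divides; ∣m+n∣m⇒∣n; ∣-trans; n∣m*n; m%n≡0⇒n∣m)
  open import Data.Nat.Induction using (<-rec)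
  open import Data.Nat.Properties
  open import Data.Nat.Tactic.RingSolver using (solve-∀)
  open import Data.Product.Base using (∃-syntax; _×_; _,_; proj₁; proj₂)
  open import Data.Sum.Base using (_⊎_; inj₁; inj₂)
  open import Data.Unit.Base using (⊤)
  open import Level using (0ℓ)
  open import Relation.Binary.Core using (Rel)
  open import Relation.Binary.Definitions using (Decidable; DecidableEquality)
  open import Relation.Binary.PropositionalEquality
  open import Relation.Nullary using (¬_; yes; no; ¬?; contradiction)
  open import Relation.Nullary.Decidable using (map′; _×-dec_)

  -- Finite sets of nodes as lists

  lookup-injective : ∀ {A : Set} {xs : List A} → Unique xs →
    ∀ i j → lookup xs i ≡ lookup xs j → i ≡ j
  lookup-injective (x∉ ∷ u) zero    zero    eq = refl
  lookup-injective (x∉ ∷ u) zero    (suc j) eq = contradiction eq (All.lookup x∉ (∈-lookup j))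
  lookup-injective (x∉ ∷ u) (suc i) zero    eq = contradiction (sym eq) (All.lookup x∉ (∈-lookup i))
  lookup-injective (x∉ ∷ u) (suc i) (suc j) eq = cong suc (lookup-injective u i j eq)

  unique⇒length≤ : ∀ {N} {xs : List (Fin N)} → Unique xs → length xs ≤ N
  unique⇒length≤ u = Fin.injective⇒≤ (λ {i} {j} → lookup-injective u i j)

  module _ {N : ℕ} where

    open import Data.List.Membership.DecPropositional (Fin._≟_ {N}) using (_∈?_; _∉?_)

    -- The elements of Fin N that are not in ys, without repetition.
    complement : List (Fin N) → List (Fin N)
    complement ys = filter (_∉? ys) (allFin N)

    ∈⊎∈complement : ∀ ys x → x ∈ ys ⊎ x ∈ complement ys
    ∈⊎∈complement ys x with x ∈? ys
    ... | yes x∈ = inj₁ x∈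
    ... | no  x∉ = inj₂ (∈-filter⁺ (_∉? ys) (∈-allFin x) x∉)

    length-complement : ∀ {ys} → Unique ys → length ys + length (complement ys) ≤ N
    length-complement {ys} u = subst (_≤ N) (length-++ ys)
      (unique⇒length≤ (Unique.++⁺ u (Unique.filter⁺ (_∉? ys) (Unique.allFin⁺ N))
        λ (y∈ , y∈ᶜ) → proj₂ (∈-filter⁻ (_∉? ys) {xs = allFin N} y∈ᶜ) y∈))

  -- The nodes x with f x = s, without repetition.
  fibre : ∀ {N} → (Fin N → ℕ) → ℕ → List (Fin N)
  fibre {N} f s = filter (λ x → f x ≟ s) (allFin N)

  ∈-fibre⁺ : ∀ {N} (f : Fin N → ℕ) {s x} → f x ≡ s → x ∈ fibre f s
  ∈-fibre⁺ f {s} eq = ∈-filter⁺ (λ x → f x ≟ s) (∈-allFin _) eq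

  ∈-fibre⁻ : ∀ {N} (f : Fin N → ℕ) {s x} → x ∈ fibre f s → f x ≡ s
  ∈-fibre⁻ {N} f {s} x∈ = proj₂ (∈-filter⁻ (λ x → f x ≟ s) {xs = allFin N} x∈)

  fibres≥⇒*≤ : ∀ {N} (f : Fin N → ℕ) c m →
    (∀ (s : Fin c) → m ≤ length (fibre f (toℕ s))) → c * m ≤ N
  fibres≥⇒*≤ {N} f c m m≤ = Fin.injective⇒≤ {f = F} F-injective
    where
    -- The j-th element of the s-th fibre; the fibres are disjoint.
    pick : Fin c × Fin m → Fin N
    pick (s , j) = lookup (fibre f (toℕ s)) (inject≤ j (m≤ s))

    f-pick : ∀ p → f (pick p) ≡ toℕ (proj₁ p)
    f-pick (s , j) = ∈-fibre⁻ f (∈-lookup (inject≤ j (m≤ s)))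

    pick-injective : ∀ p q → pick p ≡ pick q → p ≡ q
    pick-injective p@(s , j) q@(t , k) eq
      with refl ← Fin.toℕ-injective (trans (sym (f-pick p)) (trans (cong f eq) (f-pick q)))
      = cong (s ,_) (Fin.inject≤-injective (m≤ s) (m≤ s) j k
          (lookup-injective (Unique.filter⁺ (λ x → f x ≟ toℕ s) (Unique.allFin⁺ N)) _ _ eq))

    F : Fin (c * m) → Fin N
    F x = pick (remQuot m x)

    F-injective : ∀ {x y} → F x ≡ F y → x ≡ y
    F-injective {x} {y} eq = trans (sym (Fin.combine-remQuot {c} m x))
      (trans (cong (λ (s , j) → combine s j) (pick-injective _ _ eq)) (Fin.combine-remQuot {c} m y))

  -- Pigeonhole: one of the c fibres over 0, ..., c - 1 has at most N / c elements.
  -- Values of f outside this range are allowed.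
  small-fibre : ∀ {N} (f : Fin N → ℕ) c .⦃ _ : NonZero c ⦄ →
    ∃[ s ] s < c × c * length (fibre f s) ≤ N
  small-fibre {N} f c
    with Fin.¬∀⟶∃¬ c (λ s → suc (N / c) ≤ length (fibre f (toℕ s)))
           (λ s → suc (N / c) ≤? length (fibre f (toℕ s)))
           (λ all → <⇒≱ N<c*[1+N/c] (fibres≥⇒*≤ f c (suc (N / c)) all))
    where
    N<c*[1+N/c] : N < c * suc (N / c)
    N<c*[1+N/c] = begin-strict
      N                   ≡⟨ m≡m%n+[m/n]*n N c ⟩
      N % c + N / c * c   <⟨ +-monoˡ-< (N / c * c) (m%n<n N c) ⟩
      c + N / c * c       ≡⟨ *-comm (suc (N / c)) c ⟩
      c * suc (N / c)     ∎
      where open ≤-Reasoning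
  ... | s , small = toℕ s , Fin.toℕ<n s , (begin
      c * length (fibre f (toℕ s)) ≤⟨ *-monoʳ-≤ c (≤-pred (≰⇒> small)) ⟩
      c * (N / c)                  ≡⟨ *-comm c (N / c) ⟩
      N / c * c                    ≤⟨ m/n*n≤m N c ⟩
      N                            ∎)
      where open ≤-Reasoning

  module _ {A : Set} (_≟ᴬ_ : DecidableEquality A) where

    -- All occurrences of a are removed.
    remove : A → List A → List A
    remove a = filter (λ x → ¬? (x ≟ᴬ a))

    length-remove : ∀ {a xs} → a ∈ xs → length (remove a xs) < length xs
    length-remove {a} {xs} a∈ =
      filter-notAll (λ x → ¬? (x ≟ᴬ a)) xs (lose a∈ (λ a≢a → a≢a refl))

    ∈-remove⁺ : ∀ {a x xs} → x ∈ xs → x ≢ a → x ∈ remove a xs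
    ∈-remove⁺ {a} = ∈-filter⁺ (λ x → ¬? (x ≟ᴬ a))

  -- Walks of a given length

  -- Walk R n x y: the walks of exactly n steps of R from x to y.  As R is an
  -- arbitrary relation, Walk (Walk R g) consists of the walks in the graph whose
  -- edges are the walks of length g.
  data Walk {A : Set} (R : Rel A 0ℓ) : ℕ → Rel A 0ℓ where
    []  : ∀ {x} → Walk R 0 x x
    _∷_ : ∀ {n x y z} → R x y → Walk R n y z → Walk R (suc n) x z

  module _ {A : Set} {R : Rel A 0ℓ} where

    cast : ∀ {m n x y} → m ≡ n → Walk R m x y → Walk R n x y
    cast {x = x} {y} = subst (λ k → Walk R k x y)

    infixr 5 _◅◅_

    _◅◅_ : ∀ {m n x y z} → Walk R m x y → Walk R n y z → Walk R (m + n) x z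
    []      ◅◅ q = q
    (e ∷ p) ◅◅ q = e ∷ (p ◅◅ q)

    splitAt : ∀ m {n x z} → Walk R (m + n) x z → ∃[ y ] Walk R m x y × Walk R n y z
    splitAt zero    p       = _ , [] , p
    splitAt (suc m) (e ∷ p) = let y , q , r = splitAt m p in y , e ∷ q , r

    lastEdge : ∀ {n x y} → Walk R (suc n) x y → ∃[ z ] R z y
    lastEdge (e ∷ [])        = _ , e
    lastEdge (e ∷ p@(_ ∷ _)) = lastEdge p

    concatWalk : ∀ {g m x y} → Walk (Walk R g) m x y → Walk R (m * g) x y
    concatWalk []      = []
    concatWalk (p ∷ q) = p ◅◅ concatWalk q

    chop : ∀ {g} m {x y} → Walk R (m * g) x y → Walk (Walk R g) m x y
    chop         zero    [] = []
    chop {g = g} (suc m) p  = let _ , q , r = splitAt g p in q ∷ chop m r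

    pad : ∀ {m n x y} → R x x → m ≤ n → Walk R m x y → Walk R n x y
    pad {m} {n} {x} {y} l m≤n p = cast (m∸n+n≡m m≤n) (loops (n ∸ m))
      where
      loops : ∀ k → Walk R (k + m) x y
      loops zero    = p
      loops (suc k) = l ∷ loops k

    -- The start nodes of the steps of a walk, in order: all nodes but the last.
    sources : ∀ {n x y} → Walk R n x y → List A
    sources []                = []
    sources (_∷_ {x = x} e p) = x ∷ sources p

    length-sources : ∀ {n x y} (p : Walk R n x y) → length (sources p) ≡ n
    length-sources []      = refl
    length-sources (e ∷ p) = cong suc (length-sources p)

    start∈sources : ∀ {n x y} (p : Walk R (suc n) x y) → x ∈ sources p
    start∈sources (e ∷ p) = here refl

    -- Cutting a walk at the start node of one of its steps.
    cut : ∀ {n x y v} (p : Walk R n x y) → v ∈ sources p →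
      ∃[ a ] ∃[ b ] Walk R a x v × Walk R (suc b) v y × a + suc b ≡ n
    cut p@(_ ∷ _) (here refl) = 0 , _ , [] , p , refl
    cut (e ∷ p)   (there v∈) =
      let a , b , q , r , eq = cut p v∈ in suc a , b , e ∷ q , r , cong suc eq

    -- A walk not longer than any nonempty closed walk repeats no node, except that
    -- its last node may have occurred before.
    sources-unique : ∀ {g} → (∀ {k x} → Walk R (suc k) x x → g ≤ suc k) →
      ∀ {n x y} → n ≤ g → (p : Walk R n x y) → Unique (sources p)
    sources-unique         min n≤g []      = []
    sources-unique {g = g} min {n = suc n} {x = x} n<g (e ∷ p) =
      All.tabulate x∉ ∷ sources-unique min (<⇒≤ n<g) p
      where
      x∉ : ∀ {v} → v ∈ sources p → x ≢ v
      x∉ v∈ refl with a , b , q , r , eq ← cut p v∈ = <⇒≱ n<g (begin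
        g           ≤⟨ min (e ∷ q) ⟩
        suc a       ≤⟨ m≤m+n (suc a) b ⟩
        suc a + b   ≡⟨ trans (sym (+-suc a b)) eq ⟩
        n           ∎)
        where open ≤-Reasoning

    -- One step along a closed walk, which is rotated to start at the next node.
    advance : ∀ {n x} → Walk R (suc n) x x → ∃[ y ] R x y × Walk R (suc n) y y
    advance {n} (e ∷ p) =
      _ , e , cast (+-comm n 1) (p ◅◅ (e ∷ []))

    -- A walk of any length can be made along a closed walk.
    run : ∀ L {n x} → Walk R (suc n) x x → ∃[ y ] Walk R L x y × Walk R (suc n) y y
    run zero    l = _ , [] , l
    run (suc L) l =
      let _ , e , l′ = advance l
          z , p , l″ = run L l′
      in  z , e ∷ p , l″

    -- Shortening walks by pigeonhole

    -- Reaches T xs x: some walk from x stops at a node satisfying T, and each of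
    -- its earlier nodes is in xs.
    data Reaches (T : A → Set) (xs : List A) : A → Set where
      arrive : ∀ {x} → T x → Reaches T xs x
      step   : ∀ {x y} → x ∈ xs → R x y → Reaches T xs y → Reaches T xs x

    -- A walk to T along which the invariant I holds can be stopped at the first node
    -- where the alternative offered by I is T.
    walk⇒reaches : ∀ {T I : A → Set} {xs} →
      (∀ {x y} → R x y → I x → I y) → (∀ {x} → I x → T x ⊎ x ∈ xs) →
      ∀ {n x y} → Walk R n x y → I x → T y → Reaches T xs x
    walk⇒reaches inv split []      i t = arrive t
    walk⇒reaches inv split (e ∷ p) i t with split i
    ... | inj₁ t′ = arrive t′
    ... | inj₂ x∈ = step x∈ e (walk⇒reaches inv split p (inv e i) t)

    module _ (_≟ᴬ_ : DecidableEquality A) where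

      -- Either the walk avoids a, or its part after the last visit to a does.
      leave : ∀ {T xs} a {x} → Reaches T xs x →
        Reaches T (remove _≟ᴬ_ a xs) x ⊎ ∃[ y ] R a y × Reaches T (remove _≟ᴬ_ a xs) y
      leave a (arrive t) = inj₁ (arrive t)
      leave a (step {x} {y} x∈ e r) with leave a r
      ... | inj₂ left = inj₂ left
      ... | inj₁ r′ with x ≟ᴬ a
      ...   | yes refl = inj₂ (y , e , r′)
      ...   | no x≢a   = inj₁ (step (∈-remove⁺ _≟ᴬ_ x∈ x≢a) e r′)

      -- The nodes before the target can be made distinct, so length xs steps suffice.
      shortWalk : ∀ {T} k {xs x} → length xs ≤ k → Reaches T xs x →
        ∃[ m ] ∃[ y ] m ≤ k × Walk R m x y × T y
      shortWalk k       xs≤k (arrive t) = 0 , _ , z≤n , [] , t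
      shortWalk zero    xs≤0 (step x∈ e r) = contradiction (≤-trans (length-remove _≟ᴬ_ x∈) xs≤0) λ ()
      shortWalk (suc k) {x = x} xs≤k (step x∈ e r) =
        let y , e′ , r′ = leaves (leave x r)
            m , z , m≤k , p , t = shortWalk k (≤-pred (≤-trans (length-remove _≟ᴬ_ x∈) xs≤k)) r′
        in  suc m , z , s≤s m≤k , e′ ∷ p , t
        where
        leaves : ∀ {B : A → Set} → B _ ⊎ ∃[ y ] R x y × B y → ∃[ y ] R x y × B y
        leaves (inj₁ b) = _ , e , b
        leaves (inj₂ b) = b

  walk? : ∀ {N} {E : Rel (Fin N) 0ℓ} → Decidable E → ∀ n → Decidable (Walk E n)
  walk? E? zero    i j = map′ (λ { refl → [] }) (λ { [] → refl }) (i Fin.≟ j)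
  walk? E? (suc n) i j = map′ (λ (k , e , p) → e ∷ p) (λ { (e ∷ p) → _ , e , p })
    (Fin.any? λ k → E? i k ×-dec walk? E? n k j)

  ¬¬-least : ∀ {P : ℕ → Set} {n} → P n → ¬ ¬ (∃[ m ] P m × ∀ {k} → k < m → ¬ P k)
  ¬¬-least {P} p none = <-rec (λ m → ¬ P m) (λ m ih pm → none (m , pm , ih)) _ p

  -- Closed walks in a strongly connected graph

  -- Strong connectedness, a shortest nonempty closed walk, and the gcd c of the
  -- closed walk lengths, all expressed with walks.  The girth is given as
  -- suc g-1 because g-1 serves as a coefficient congruent to -1 modulo the girth.
  module Connected {N : ℕ} {E : Rel (Fin N) 0ℓ}
    (connected : ∀ i j → ∃[ n ] Walk E n i j)
    (g-1 : ℕ) {o : Fin N} (cycle : Walk E (suc g-1) o o)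
    (g≤ : ∀ {k x} → Walk E (suc k) x x → suc g-1 ≤ suc k)
    {c : ℕ} ⦃ _ : NonZero c ⦄ (c∣ : ∀ {n x} → Walk E n x x → c ∣ n)
    (greatest : ∀ d → (∀ {n x} → Walk E n x x → d ∣ n) → d ∣ c)
    where

    g : ℕ
    g = suc g-1

    c∣g : c ∣ g
    c∣g = c∣ cycle

    -- The nodes of the shortest closed walk.
    C : List (Fin N)
    C = sources cycle

    C-unique : Unique C
    C-unique = sources-unique g≤ ≤-refl cycle

    g+complement≤N : g + length (complement C) ≤ N
    g+complement≤N = subst (λ k → k + length (complement C) ≤ N) (length-sources cycle)
      (length-complement C-unique)

    g≤N : g ≤ N
    g≤N = ≤-trans (m≤m+n g _) g+complement≤N

    loopAt : ∀ {v} → v ∈ C → Walk E g v v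
    loopAt {v} v∈ = let a , b , p , q , eq = cut cycle v∈ in
      cast (trans (+-comm (suc b) a) eq) (q ◅◅ p)

    -- From every node, some node on a closed walk of length g is at most N - g steps
    -- away.
    toCycle : ∀ i → ∃[ m ] ∃[ v ] g + m ≤ N × Walk E m i v × Walk E g v v
    toCycle i =
      let m , v , m≤ , p , v∈ = shortWalk Fin._≟_ (length (complement C)) ≤-refl
            (walk⇒reaches {T = _∈ C} {I = λ _ → ⊤} _ (λ {x} _ → ∈⊎∈complement C x)
              (proj₂ (connected i o)) _ (start∈sources cycle))
      in  m , v , ≤-trans (+-monoʳ-≤ g m≤) g+complement≤N , p , loopAt v∈

    -- Walks of every length end at i, since every node has a predecessor.
    into : ∀ s i → ∃[ w ] Walk E s w i
    into zero    i = i , []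
    into (suc s) i =
      let w , p     = into s i
          _ , e , _ = advance cycle
          z , e′    = lastEdge (e ∷ proj₂ (connected _ w))
      in  z , e′ ∷ p

    module _ {v : Fin N} (l : Walk E g v v) where

      -- r is congruent modulo g to the length of a closed walk at v.  The walk is
      -- required to be at least as long as r, which loses nothing as l can be repeated.
      Residue : ℕ → Set
      Residue r = ∃[ b ] Walk E (r + b * g) v v

      residue-walk : ∀ {n} → Walk E n v v → Residue n
      residue-walk p = 0 , cast (sym (+-identityʳ _)) p

      residue-+ : ∀ {x y} → Residue x → Residue y → Residue (x + y)
      residue-+ {x} {y} (a , p) (b , q) = a + b , cast (eq x y a b g) (p ◅◅ q)
        where
        eq : ∀ x y a b g → x + a * g + (y + b * g) ≡ x + y + (a + b) * g
        eq = solve-∀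

      residue-* : ∀ k {x} → Residue x → Residue (k * x)
      residue-* zero    r = 0 , []
      residue-* (suc k) r = residue-+ r (residue-* k r)

      -- Subtracting y amounts to adding (g - 1) y.
      residue-cancel : ∀ {x y} → Residue (x + y) → Residue y → Residue x
      residue-cancel {x} {y} rxy ry =
        let b , p = residue-+ rxy (residue-* g-1 ry) in y + b , cast (eq x y g-1 b) p
        where
        eq : ∀ x y g-1 b → x + y + g-1 * y + b * suc g-1 ≡ x + (y + b) * suc g-1
        eq = solve-∀

      -- Inserting a closed walk at u into a round trip from v through u changes the
      -- length of that round trip by the length of the closed walk.
      ∣closedAt⇒∣closed : ∀ {d} → (∀ {n} → Walk E n v v → d ∣ n) →
        ∀ {n u} → Walk E n u u → d ∣ n
      ∣closedAt⇒∣closed {d} d∣ {n} {u} r =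
        let a , p = connected v u
            b , q = connected u v
        in  ∣m+n∣m⇒∣n (subst (d ∣_) (eq a b n) (d∣ (p ◅◅ r ◅◅ q))) (d∣ (p ◅◅ q))
        where
        eq : ∀ a b n → a + (n + b) ≡ a + b + n
        eq = solve-∀

      -- The remainder modulo d of a closed walk length at v is a residue smaller than
      -- the least positive one, hence zero.
      least⇒∣c : ∀ d → NonZero d × Residue d →
        (∀ {k} → k < d → ¬ (NonZero k × Residue k)) → d ∣ c
      least⇒∣c d@(suc _) (_ , rd) least = greatest d (∣closedAt⇒∣closed d∣)
        where
        d∣ : ∀ {n} → Walk E n v v → d ∣ n
        d∣ {n} p with n % d in eq | m%n<n n d | residue-cancel {n % d}
             (subst Residue (m≡m%n+[m/n]*n n d) (residue-walk p)) (residue-* (n / d) rd)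
        ... | zero  | _   | _ = m%n≡0⇒n∣m n d eq
        ... | suc _ | r<d | r = contradiction (_ , r) (least r<d)

      -- As m is a multiple of c, so is (g - 1) m, and hence it is a residue: a closed
      -- walk at v of that length, up to multiples of g, precedes the walk of length m.
      reachable : ∀ {m w} → Walk E m v w → c ∣ m → ¬ ¬ (∃[ k ] Walk E (k * g) v w)
      reachable {m} p c∣m none =
        ¬¬-least {λ d → NonZero d × Residue d} (_ , residue-walk l) λ (d , rd , least) →
          let divides q m≡q*d = ∣-trans (least⇒∣c d rd least) c∣m
              b , r = residue-* g-1 (subst Residue (sym m≡q*d) (residue-* q (proj₂ rd)))
          in  none (m + b , cast (eq g-1 m b) (r ◅◅ p))
        where
        eq : ∀ g-1 m b → g-1 * m + b * suc g-1 + m ≡ (m + b) * suc g-1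
        eq = solve-∀

    module _ (i : Fin N) where

      -- The class of w is the common residue modulo c of the lengths of all walks from
      -- w to i (`class-walk`); it is read off from one chosen walk.
      class : Fin N → ℕ
      class w = proj₁ (connected w i) % c

      -- The nodes of class s.
      W : ℕ → List (Fin N)
      W = fibre class

      %-unique : ∀ {a x y} → c ∣ a + x → c ∣ a + y → x % c ≡ y % c
      %-unique {a} {x} {y} c∣ax c∣ay = begin
        x % c              ≡⟨ %-remove-+ˡ x c∣ay ⟨
        (a + y + x) % c    ≡⟨ cong (_% c) (eq a x y) ⟩
        (y + (a + x)) % c  ≡⟨ %-remove-+ʳ y c∣ax ⟩
        y % c              ∎
        where
        open ≡-Reasoning
        eq : ∀ a x y → a + y + x ≡ y + (a + x)
        eq = solve-∀

      class-walk : ∀ {n w} → Walk E n w i → class w ≡ n % c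
      class-walk {w = w} p =
        let _ , q = connected i w in %-unique (c∣ (q ◅◅ proj₂ (connected w i))) (c∣ (q ◅◅ p))

      class-step : ∀ {s x y} → Walk E g x y → class x ≡ s → class y ≡ s
      class-step {y = y} p x∈s = let n , q = connected y i in
        trans (sym (%-remove-+ˡ n c∣g)) (trans (sym (class-walk (p ◅◅ q))) x∈s)

      -- In the graph of walks of length g, walks from v stay in the class s, whose at
      -- most M + 1 nodes include the target w; so M steps suffice, and the loop l at v
      -- makes up for missing ones.
      uniformReach : ∀ {s k M v w} → length (W s) ≤ suc M → class v ≡ s →
        Walk E g v v → Walk E (k * g) v w → Walk E (M * g) v w
      uniformReach {s} {k} {M} {v} {w} W≤ v∈ l p =
        let m , y , m≤M , q , y≡w = shortWalk Fin._≟_ M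
              (≤-pred (≤-trans (length-remove Fin._≟_ w∈W) W≤))
              (walk⇒reaches {T = _≡ w} class-step targetOrNot (chop {g = g} k p) v∈ refl)
        in  subst (Walk E (M * g) v) y≡w (concatWalk (pad l m≤M q))
        where
        stay : ∀ {m x y} → Walk (Walk E g) m x y → class x ≡ s → class y ≡ s
        stay []      x∈ = x∈
        stay (e ∷ q) x∈ = stay q (class-step e x∈)

        w∈W : w ∈ W s
        w∈W = ∈-fibre⁺ class (stay (chop {g = g} k p) v∈)

        targetOrNot : ∀ {x} → class x ≡ s → x ≡ w ⊎ x ∈ remove Fin._≟_ w (W s)
        targetOrNot {x} x∈ with x Fin.≟ w
        ... | yes x≡w = inj₁ x≡w
        ... | no  x≢w = inj₂ (∈-remove⁺ Fin._≟_ (∈-fibre⁺ class x∈) x≢w)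

      -- The hypothesis on n says n ≥ N + h N + c - 1 - 2 g.
      ¬¬closedWalk : ∀ {h n} → h * c ≡ g → c ∣ n →
        N + h * N + c ≤ suc (n + 2 * g) → ¬ ¬ Walk E n i i
      ¬¬closedWalk {h} {n} hc≡g c∣n bound none
        with s , s<c , small ← small-fibre class c
        with w , back ← into s i
        with w∈ ← trans (class-walk back) (m<n⇒m%n≡m s<c)
        with length (W s) in |W|≡ | ∈-length (∈-fibre⁺ class w∈)
      ... | suc M | _ =
        -- pre is the piece of length L from i to v, t′ connects v to w in steps of
        -- length g, and back is the piece of length s from w to i.
        let m , u , g+m≤N , p , l = toCycle i
            L          = n ∸ (s + M * g)
            m+[s+Mg]≤n = enough g+m≤N
            n≡         = m∸n+n≡m (≤-trans (m≤n+m _ m) m+[s+Mg]≤n)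
            v , q , l′ = run (L ∸ m) l
            pre        = cast (m+[n∸m]≡n (m+n≤o⇒m≤o∸n m m+[s+Mg]≤n)) (p ◅◅ q)
            _ , r      = connected v i
            d , t      = connected v w
            c∣L+s      = ∣m+n∣m⇒∣n (subst (c ∣_) (trans (sym n≡) (eq L s M g)) c∣n)
                           (∣-trans c∣g (n∣m*n M))
            v∈         = trans (%-unique {L} (c∣ (pre ◅◅ r)) c∣L+s) (m<n⇒m%n≡m s<c)
            c∣d        = ∣m+n∣m⇒∣n (subst (c ∣_) (eq′ L d s) (c∣ (pre ◅◅ t ◅◅ back))) c∣L+s
        in  reachable l′ t c∣d λ (k , t′) → none (cast (trans (eq″ L M g s) n≡)
              (pre ◅◅ uniformReach {k = k} {M = M} (≤-reflexive |W|≡) v∈ l′ t′ ◅◅ back))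
        where
        eq : ∀ L s M g → L + (s + M * g) ≡ M * g + (L + s)
        eq = solve-∀

        eq′ : ∀ L d s → L + (d + s) ≡ L + s + d
        eq′ = solve-∀

        eq″ : ∀ L M g s → L + (M * g + s) ≡ L + (s + M * g)
        eq″ = solve-∀

        enough : ∀ {m} → g + m ≤ N → m + (s + M * g) ≤ n
        enough {m} g+m≤N = +-cancelʳ-≤ (2 * g) _ _ (≤-pred (begin
          suc (m + (s + M * g) + 2 * g)         ≡⟨ eq‴ m s M g ⟩
          g + m + g * suc M + suc s             ≡⟨ cong (λ x → g + m + x * suc M + suc s) hc≡g ⟨
          g + m + h * c * suc M + suc s         ≡⟨ cong (λ x → g + m + x + suc s) (*-assoc h c (suc M)) ⟩
          g + m + h * (c * suc M) + suc s       ≤⟨ +-mono-≤ (+-mono-≤ g+m≤N (*-monoʳ-≤ h small)) s<c ⟩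
          N + h * N + c                         ≤⟨ bound ⟩
          suc (n + 2 * g)                       ∎))
          where
          open ≤-Reasoning
          eq‴ : ∀ m s M g → suc (m + (s + M * g) + 2 * g) ≡ g + m + g * suc M + suc s
          eq‴ = solve-∀

-- Integer thresholds and bounds

module Integers where

  open import Data.Integer.Base hiding (suc)
  open import Data.Integer.Properties
  open import Data.Integer.Tactic.RingSolver using (solve-∀)
  open import Data.Nat.Base as ℕ using (ℕ; suc; zero)
  open import Data.Product.Base using (∃-syntax; _×_; _,_)
  open import Relation.Binary.PropositionalEquality
  open import Relation.Nullary using (¬_; Dec; yes; no; contradiction)

  -- If a decidable property holds from k on and fails at b, there is a least e from
  -- which on it holds.  The fuel bounds the distance from b to k.
  leastStart : ∀ {Q : ℤ → Set} → (∀ n → Dec (Q n)) → ∀ {b} → ¬ Q b →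
    ∀ fuel {k} → k ≤ b + + fuel → (∀ n → k ≤ n → Q n) →
    ∃[ e ] (∀ n → e ≤ n → Q n) × (∀ k′ → (∀ n → k′ ≤ n → Q n) → e ≤ k′) × e ≤ k
  leastStart Q? {b} ¬Qb zero {k} k≤b from =
    contradiction (from b (subst (k ≤_) (+-identityʳ b) k≤b)) ¬Qb
  leastStart {Q} Q? {b} ¬Qb (suc fuel) {k} k≤ from with Q? (pred k)
  ... | no ¬Q = k , from , least , ≤-refl
    where
    least : ∀ k′ → (∀ n → k′ ≤ n → Q n) → k ≤ k′
    least k′ from′ = ≮⇒≥ λ k′<k → ¬Q (from′ (pred k) (i<j⇒i≤pred[j] k′<k))
  ... | yes q =
    let e , holds , least , e≤ = leastStart Q? ¬Qb fuel pred-k≤ from′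
    in  e , holds , least , ≤-trans e≤ (i≤j⇒pred[i]≤j ≤-refl)
    where
    pred-k≤ : pred k ≤ b + + fuel
    pred-k≤ = subst (pred k ≤_) (eq b (+ fuel)) (pred-mono k≤)
      where
      eq : ∀ b f → - 1ℤ + (b + (1ℤ + f)) ≡ b + f
      eq = solve-∀

    from′ : ∀ n → pred k ≤ n → Q n
    from′ n k-1≤n with pred k ≟ n
    ... | yes refl = q
    ... | no k-1≢n = from n (subst (_≤ n) (suc-pred k) (i<j⇒suc[i]≤j (≤∧≢⇒< k-1≤n k-1≢n)))

  module _ {K N h g c : ℕ} (K+[1+2g]≡ : K ℕ.+ suc (2 ℕ.* g) ≡ N ℕ.+ h ℕ.* N ℕ.+ c) where

    K-explicit : + K ≡ + N + + h * + N + + c - (1ℤ + + 2 * + g)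
    K-explicit = begin
      + K                                            ≡⟨ cancel (+ K) (1ℤ + + 2 * + g) ⟩
      + K + (1ℤ + + 2 * + g) - (1ℤ + + 2 * + g)      ≡⟨ cong (_- (1ℤ + + 2 * + g)) cast ⟩
      + N + + h * + N + + c - (1ℤ + + 2 * + g)       ∎
      where
      open ≡-Reasoning
      cancel : ∀ k x → k ≡ k + x - x
      cancel = solve-∀

      cast : + K + (1ℤ + + 2 * + g) ≡ + N + + h * + N + + c
      cast rewrite sym (pos-* h N) | sym (pos-* 2 g) = cong +_ K+[1+2g]≡

    -- The difference of the two sides is (h - 1) (N - 1).
    generalBound : 1 ℕ.≤ h → 1 ℕ.≤ N → + K ≤ + 2 * + h * + N - + h - + 2 * + g + + c
    generalBound 1≤h 1≤N = begin
      + K                                              ≤⟨ i≤i+j (+ K) (+ x) ⟩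
      + K + + x                                        ≡⟨ cong₂ _+_ K-explicit x≡ ⟩
      + N + + h * + N + + c - (1ℤ + + 2 * + g)
        + (+ h - 1ℤ) * (+ N - 1ℤ)                      ≡⟨ eq (+ N) (+ h) (+ g) (+ c) ⟩
      + 2 * + h * + N - + h - + 2 * + g + + c          ∎
      where
      open ≤-Reasoning

      x : ℕ
      x = (h ℕ.∸ 1) ℕ.* (N ℕ.∸ 1)

      pred≡ : ∀ {m} → 1 ℕ.≤ m → + (m ℕ.∸ 1) ≡ + m - 1ℤ
      pred≡ (ℕ.s≤s _) = refl

      x≡ : + x ≡ (+ h - 1ℤ) * (+ N - 1ℤ)
      x≡ = trans (pos-* (h ℕ.∸ 1) (N ℕ.∸ 1)) (cong₂ _*_ (pred≡ 1≤h) (pred≡ 1≤N))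

      eq : ∀ N h g c → N + h * N + c - (1ℤ + + 2 * g) + (h - 1ℤ) * (N - 1ℤ)
                     ≡ + 2 * h * N - h - + 2 * g + c
      eq = solve-∀

    primitiveBound : h ≡ g → c ≡ 1 → + K ≡ + N + (+ N - + 2) * + g
    primitiveBound refl refl = trans K-explicit (eq (+ N) (+ g))
      where
      eq : ∀ N g → N + g * N + 1ℤ - (1ℤ + + 2 * g) ≡ N + (N - + 2) * g
      eq = solve-∀

open import Defs
open import Data.Integer.Base using (ℤ; +_; _+_; _-_; _*_; _≤_)
open import Data.Nat.Base using (ℕ; _/_)
open import Data.Product.Base using (∃-syntax; _×_)
open import Relation.Binary.PropositionalEquality.Core using (_≡_)

import Data.Fin.Properties as Fin
open import Data.Integer.Base using (-[1+_]; -_; +≤+)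
open import Data.Integer.Divisibility using (_∣_)
import Data.Integer.Properties as ℤ
import Data.Nat.Base as ℕ
import Data.Nat.Divisibility as ℕ
import Data.Nat.DivMod as ℕ
import Data.Nat.Properties as ℕ
open import Data.Product.Base using (_,_; proj₁; proj₂)
open import Relation.Binary.Construct.Closure.ReflexiveTransitive using (ε; _◅_)
open import Relation.Binary.PropositionalEquality using (refl; sym; trans; cong; subst)
open import Relation.Nullary using (¬_; Dec; yes; no; contradiction)
open import Relation.Nullary.Decidable using (map′; decidable-stable; _→-dec_)
open WalkLengths
open Integers

-- Exploration penalty of a graph

module _ {N : ℕ} (G : Graph N) where
  open Graph G

  path⇒walk : ∀ {i j} (p : Path G i j) → Walk E (length G p) i j
  path⇒walk ε       = []
  path⇒walk (e ◅ p) = e ∷ path⇒walk p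

  walk⇒path : ∀ {n i j} → Walk E n i j → ∃[ p ] length G {i} {j} p ≡ n
  walk⇒path []      = ε , refl
  walk⇒path (e ∷ w) = let p , eq = walk⇒path w in e ◅ p , cong ℕ.suc eq

  -- The condition that the exploration penalty imposes on a single length n.
  ClosedAtAll : ℕ → ℤ → Set
  ClosedAtAll c n = + c ∣ n → ∀ i → ∃[ p ] + length G {i} {i} p ≡ n

  closedAtAll? : ∀ c n → Dec (ClosedAtAll c n)
  closedAtAll? c n = (c ℕ.∣? _) →-dec Fin.all? (λ i → closedAt? i n)
    where
    closedAt? : ∀ i n → Dec (∃[ p ] + length G {i} {i} p ≡ n)
    closedAt? i (+ n)    = map′ (λ w → let p , eq = walk⇒path w in p , cong +_ eq)
      (λ { (p , refl) → path⇒walk p }) (walk? E? n i i)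
    closedAt? i -[1+ n ] = no λ ()

  ¬closedAtAll-neg : ∀ c .⦃ _ : ℕ.NonZero c ⦄ → Nontrivial G → ¬ ClosedAtAll c (- + c)
  ¬closedAtAll-neg (ℕ.suc _) (i , _) closed with () ← proj₂ (closed ℕ.∣-refl i)

  module _ (sc : StronglyConnected G) {g-1 c : ℕ}
    (isG : IsGirth G (ℕ.suc g-1)) (isC : IsCyclicity G c) where

    private
      g : ℕ
      g = ℕ.suc g-1

    private instance
      c≢0 : ℕ.NonZero c
      c≢0 = cyclicity-nonZero isG isC

    c∣closed : ∀ {n i} → Walk E n i i → c ℕ.∣ n
    c∣closed {ℕ.zero}  w = c ℕ.∣0
    c∣closed {ℕ.suc n} w = IsCyclicity.commonDivisor isC _ (_ , _ , walk⇒path w)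

    ∣closed⇒∣c : ∀ d → (∀ {n i} → Walk E n i i → d ℕ.∣ n) → d ℕ.∣ c
    ∣closed⇒∣c d d∣ = IsCyclicity.greatest isC d
      λ { n (_ , _ , p , refl) → d∣ (path⇒walk p) }

    g≤closed : ∀ {n i} → Walk E (ℕ.suc n) i i → g ℕ.≤ ℕ.suc n
    g≤closed w = IsGirth.minimal isG _ (_ , _ , walk⇒path w)

    girthCycle : ∃[ o ] Walk E g o o
    girthCycle = let _ , o , p , eq = IsGirth.attained isG in o , cast eq (path⇒walk p)

    connected : ∀ i j → ∃[ n ] Walk E n i j
    connected i j = _ , path⇒walk (sc i j)

    module Walks = Connected connected g-1
      (proj₂ girthCycle) g≤closed c∣closed ∣closed⇒∣c

    module _ {h : ℕ} (hc≡g : h ℕ.* c ≡ g) where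

      -- N + h N + c - 1 - 2 g; the subtraction is exact by `threshold+[1+2g]≡`.
      threshold : ℕ
      threshold = (N ℕ.+ h ℕ.* N ℕ.+ c) ℕ.∸ ℕ.suc (2 ℕ.* g)

      threshold+[1+2g]≡ : threshold ℕ.+ ℕ.suc (2 ℕ.* g) ≡ N ℕ.+ h ℕ.* N ℕ.+ c
      threshold+[1+2g]≡ = ℕ.m∸n+n≡m (begin
        ℕ.suc (2 ℕ.* g)          ≡⟨ ℕ.+-comm 1 (2 ℕ.* g) ⟩
        2 ℕ.* g ℕ.+ 1            ≡⟨ cong (λ x → g ℕ.+ x ℕ.+ 1) (ℕ.+-identityʳ g) ⟩
        g ℕ.+ g ℕ.+ 1            ≤⟨ ℕ.+-mono-≤ (ℕ.+-mono-≤ Walks.g≤N g≤hN) (ℕ.>-nonZero⁻¹ c) ⟩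
        N ℕ.+ h ℕ.* N ℕ.+ c      ∎)
        where
        open ℕ.≤-Reasoning
        g≤hN : g ℕ.≤ h ℕ.* N
        g≤hN = subst (ℕ._≤ h ℕ.* N) hc≡g
          (ℕ.*-monoʳ-≤ h (ℕ.≤-trans (ℕ.∣⇒≤ Walks.c∣g) Walks.g≤N))

      closedFromThreshold : ∀ n → + threshold ≤ n → ClosedAtAll c n
      closedFromThreshold (+ n) (+≤+ K≤n) c∣n i =
        let p , eq = walk⇒path (decidable-stable (walk? E? n i i)
              (Walks.¬¬closedWalk i {h} hc≡g c∣n bound))
        in  p , cong +_ eq
        where
        bound : N ℕ.+ h ℕ.* N ℕ.+ c ℕ.≤ ℕ.suc (n ℕ.+ 2 ℕ.* g)
        bound = subst (N ℕ.+ h ℕ.* N ℕ.+ c ℕ.≤_) (ℕ.+-suc n (2 ℕ.* g))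
          (subst (ℕ._≤ n ℕ.+ ℕ.suc (2 ℕ.* g)) threshold+[1+2g]≡ (ℕ.+-monoˡ-≤ _ K≤n))

theorem3 : ∀ {N : ℕ} (G : Graph N) → Nontrivial G → StronglyConnected G →
    ∀ {g c : ℕ} (isGirth : IsGirth G g) (isCyclicity : IsCyclicity G c) →
    let g/c = + ((g / c) ⦃ cyclicity-nonZero isGirth isCyclicity ⦄) in
    ∃[ ep ] IsExplorationPenalty G c ep
    × ep ≤ + 2 * g/c * + N - g/c - + 2 * + g + + c
    × (c ≡ 1 → ep ≤ + N + (+ N - + 2) * + g)
-- A nonempty path has positive length, so the girth is not 0.
theorem3 G nt sc {ℕ.zero} isG isC =
  contradiction refl (ℕ.≢-nonZero⁻¹ 0 ⦃ proj₁ (IsGirth.attained isG) ⦄)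
theorem3 {N} G nt sc {g@(ℕ.suc _)} {c} isG isC =
  ep ,
  record
    { holds    = λ i n ep≤n c∣n → closed n ep≤n c∣n i
    ; smallest = λ k′ closed′ → least k′ (λ n k′≤n c∣n i → closed′ i n k′≤n c∣n)
    } ,
  ℤ.≤-trans ep≤K (generalBound {g = g} K≡ 1≤h (ℕ.>-nonZero⁻¹ N)) ,
  λ c≡1 → subst (ep ≤_) (primitiveBound {g = g} K≡ (h≡g c≡1) c≡1) ep≤K
  where
  instance
    c≢0 = cyclicity-nonZero isG isC
    N≢0 = Graph.nonEmpty G

  h = g / c

  hc≡g : h ℕ.* c ≡ g
  hc≡g = ℕ.m/n*n≡m (cyclicity∣girth isG isC)

  1≤h : 1 ℕ.≤ h
  1≤h = ℕ.n≢0⇒n>0 λ h≡0 → contradiction (trans (sym hc≡g) (cong (ℕ._* c) h≡0)) λ ()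

  h≡g : c ≡ 1 → h ≡ g
  h≡g c≡1 = trans (sym (ℕ.*-identityʳ h)) (trans (cong (h ℕ.*_) (sym c≡1)) hc≡g)

  K : ℕ
  K = threshold G sc isG isC {h} hc≡g

  K≡ : K ℕ.+ ℕ.suc (2 ℕ.* g) ≡ N ℕ.+ h ℕ.* N ℕ.+ c
  K≡ = threshold+[1+2g]≡ G sc isG isC {h} hc≡g

  K≤-c+[c+K] : + K ≤ - + c + + (c ℕ.+ K)
  K≤-c+[c+K] = ℤ.≤-reflexive (K≡-c+[c+K] (+ c) (+ K))
    where
    K≡-c+[c+K] : ∀ c k → k ≡ - c + (c + k)
    K≡-c+[c+K] c k = trans (sym (ℤ.+-identityˡ k))
      (trans (cong (_+ k) (sym (ℤ.+-inverseˡ c))) (ℤ.+-assoc (- c) c k))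

  -- The fuel c + K is the distance from - c, where the condition fails, to K.
  penalty = leastStart (closedAtAll? G c) (¬closedAtAll-neg G c nt) (c ℕ.+ K) K≤-c+[c+K]
    (closedFromThreshold G sc isG isC {h} hc≡g)

  ep     = proj₁ penalty
  closed = proj₁ (proj₂ penalty)
  least  = proj₁ (proj₂ (proj₂ penalty))
  ep≤K   = proj₂ (proj₂ (proj₂ penalty))
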